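{- Let $G$ be a graph of order $n\ge 2$ with minimum degree $\delta(G)\ge 1$, and let $k$ be an integer with $\gamma(G)\le k\le n$. If $G\cong D_k(G)$, then $k=2$, $n\ge 4$, and $G\cong K_{1,n-1}$.
   Context: Graphs are finite and simple, with nonempty vertex set. A set $S\subseteq V(G)$ is a dominating set of $G$ if every vertex in $V(G)\setminus S$ is adjacent to at least one vertex of $S$. The domination number $\gamma(G)$ is the minimum cardinality of a dominating set of $G$. For a positive integer $k$, the $k$-dominating graph $D_k(G)$ is the graph whose vertices are the dominating sets of $G$ of cardinality at most $k$, two of them being adjacent if and only if one is obtained from the other by adding or deleting a single vertex. $\cong$ denotes graph isomorphism, and $K_{1,n-1}$ is the star with $n-1$ leaves. -}

module Defs where

open import Data.Empty using (⊥)
open import Data.Fin using (Fin; zero; suc)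
open import Data.Fin.Properties using (any?; all?)
open import Data.Fin.Subset using (Subset; _∈_; _∉_; _∪_; _-_; ⁅_⁆; ∣_∣; ⊤)
open import Data.Fin.Subset.Properties using (_∈?_; anySubset?; ∈⊤; x∈⁅x⁆; x∈p∪q⁺; x∈p⇒∣p-x∣<∣p∣)
open import Data.Nat using (ℕ; zero; suc; _≤_; _<_; NonZero; s≤s⁻¹)
import Data.Nat as ℕ
open import Data.Nat.Properties using (m≤n⇒m<n∨m≡n; ≮⇒≥; n<1+n; <-irrefl)
open import Data.Bool.Properties using () renaming (_≟_ to _≟ᵇ_)
open import Data.Product using (_×_; _,_; ∃; proj₁)
open import Data.Refinement using (Refinement-syntax; value)
open import Data.Sum using (_⊎_; inj₁; inj₂; [_,_]; swap)
open import Data.Unit using (tt) renaming (⊤ to Unit)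
open import Data.Vec using (tabulate)
open import Data.Vec.Properties using (≡-dec)
open import Function.Bundles using (_↔_; _⇔_; Inverse)
open import Relation.Binary using (Rel; Symmetric; Irreflexive) renaming (Decidable to Decidable₂)
open import Relation.Binary.PropositionalEquality using (_≡_; refl; sym; cong; subst)
open import Relation.Nullary using (¬_; yes; no; does; contradiction; ¬?)
open import Relation.Nullary.Decidable using (_×-dec_; _⊎-dec_; _→-dec_)
open import Relation.Unary using (Pred; Decidable)
open import Level using (0ℓ)

-- Adjacency is decidable, as it is classically for every finite graph.
-- A finite graph of order n is a Graph (Fin n).
record Graph (V : Set) : Set₁ where
  field
    Adj        : Rel V 0ℓ
    adj?       : Decidable₂ Adj
    adj-sym    : Symmetric Adj
    adj-irrefl : Irreflexive _≡_ Adj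

open Graph

record _≅_ {V W : Set} (G : Graph V) (H : Graph W) : Set where
  field
    bijection : V ↔ W
    adj⇔adj   : ∀ u v → Adj G u v ⇔ Adj H (Inverse.to bijection u) (Inverse.to bijection v)

infix 4 _≅_

completeBipartite : (p q : ℕ) → Graph (Fin p ⊎ Fin q)
completeBipartite p q = record
  { Adj = E ; adj? = E? ; adj-sym = λ {x} {y} → E-sym x y ; adj-irrefl = λ {x} → E-irrefl x }
  where
  E : Rel (Fin p ⊎ Fin q) 0ℓ
  E (inj₁ _) (inj₁ _) = ⊥
  E (inj₁ _) (inj₂ _) = Unit
  E (inj₂ _) (inj₁ _) = Unit
  E (inj₂ _) (inj₂ _) = ⊥

  E? : Decidable₂ E
  E? (inj₁ _) (inj₁ _) = no λ ()
  E? (inj₁ _) (inj₂ _) = yes tt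
  E? (inj₂ _) (inj₁ _) = yes tt
  E? (inj₂ _) (inj₂ _) = no λ ()

  E-sym : ∀ x y → E x y → E y x
  E-sym (inj₁ _) (inj₂ _) _ = tt
  E-sym (inj₂ _) (inj₁ _) _ = tt

  E-irrefl : ∀ x {y} → x ≡ y → ¬ E x y
  E-irrefl (inj₁ _) refl ()
  E-irrefl (inj₂ _) refl ()

K[1,_] : (m : ℕ) → Graph (Fin 1 ⊎ Fin m)
K[1, m ] = completeBipartite 1 m

IsMinimum : Pred ℕ 0ℓ → Pred ℕ 0ℓ
IsMinimum P m = P m × (∀ i → P i → m ≤ i)

minimum : {P : Pred ℕ 0ℓ} → Decidable P → ∃ P → ∃ (IsMinimum P)
minimum {P} P? (b , Pb) with search (suc b)
  where
  search : ∀ b → ∃ (IsMinimum P) ⊎ (∀ i → i < b → ¬ P i)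
  search zero = inj₂ λ _ ()
  search (suc b) with search b
  ... | inj₁ m = inj₁ m
  ... | inj₂ none with P? b
  ...   | yes Pb = inj₁ (b , Pb , λ i Pi → ≮⇒≥ λ i<b → none i i<b Pi)
  ...   | no ¬Pb = inj₂ λ i i<1+b → [ none i , (λ { refl → ¬Pb }) ] (m≤n⇒m<n∨m≡n (s≤s⁻¹ i<1+b))
... | inj₁ m    = m
... | inj₂ none = contradiction Pb (none b (n<1+n b))

module _ {n : ℕ} (G : Graph (Fin n)) where

  neighbours : Fin n → Subset n
  neighbours v = tabulate λ u → does (adj? G v u)

  degree : Fin n → ℕ
  degree v = ∣ neighbours v ∣

  IsDegree : Pred ℕ 0ℓ
  IsDegree d = ∃ λ v → degree v ≡ d

  Dominating : Pred (Subset n) 0ℓ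
  Dominating S = ∀ v → v ∉ S → ∃ λ u → u ∈ S × Adj G v u

  dominating? : Decidable Dominating
  dominating? S = all? λ v → ¬? (v ∈? S) →-dec any? λ u → (u ∈? S) ×-dec adj? G v u

  IsDominatingSize : Pred ℕ 0ℓ
  IsDominatingSize m = ∃ λ S → Dominating S × ∣ S ∣ ≡ m

  minimalDominatingSize : ∃ (IsMinimum IsDominatingSize)
  minimalDominatingSize = minimum
    (λ m → anySubset? λ S → dominating? S ×-dec (∣ S ∣ ℕ.≟ m))
    (∣ ⊤ {n} ∣ , ⊤ , (λ v v∉⊤ → contradiction ∈⊤ v∉⊤) , refl)

  γ : ℕ
  γ = proj₁ minimalDominatingSize

minimalDegree : ∀ {n} .{{_ : NonZero n}} (G : Graph (Fin n)) → ∃ (IsMinimum (IsDegree G))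
minimalDegree {suc _} G = minimum
  (λ d → any? λ v → degree G v ℕ.≟ d)
  (degree G zero , zero , refl)

δ : ∀ {n} .{{_ : NonZero n}} → Graph (Fin n) → ℕ
δ G = proj₁ (minimalDegree G)

infix 4 _⟶_

-- T is obtained from S by adding or by deleting a single vertex.
_⟶_ : ∀ {n} → Rel (Subset n) 0ℓ
S ⟶ T = ∃ λ v → (v ∉ S × T ≡ S ∪ ⁅ v ⁆) ⊎ (v ∈ S × T ≡ S - v)

_⟶?_ : ∀ {n} → Decidable₂ (_⟶_ {n})
S ⟶? T = any? λ v →
  (¬? (v ∈? S) ×-dec ≡-dec _≟ᵇ_ T (S ∪ ⁅ v ⁆)) ⊎-dec ((v ∈? S) ×-dec ≡-dec _≟ᵇ_ T (S - v))

⟶-irrefl : ∀ {n} {S : Subset n} → ¬ (S ⟶ S)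
⟶-irrefl (v , inj₁ (v∉S , S≡S∪v)) =
  v∉S (subst (v ∈_) (sym S≡S∪v) (x∈p∪q⁺ (inj₂ (x∈⁅x⁆ v))))
⟶-irrefl (v , inj₂ (v∈S , S≡S-v)) =
  <-irrefl (cong ∣_∣ (sym S≡S-v)) (x∈p⇒∣p-x∣<∣p∣ v∈S)

-- The membership proof of a refinement type is irrelevant, so that equality of
-- vertices is equality of the underlying subsets.
D : ∀ {n} (k : ℕ) (G : Graph (Fin n)) → Graph [ S ∈ Subset n ∣ (Dominating G S × ∣ S ∣ ≤ k) ]
D k G = record
  { Adj        = λ S T → (value S ⟶ value T) ⊎ (value T ⟶ value S)
  ; adj?       = λ S T → (value S ⟶? value T) ⊎-dec (value T ⟶? value S)
  ; adj-sym    = swap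
  ; adj-irrefl = λ { refl → [ ⟶-irrefl , ⟶-irrefl ] }
  }

{-# OPTIONS --safe #-}
-- Let S be a minimum dominating set and s the vertex of G that corresponds to it.
-- Since D k G has an edge, γ < k, so the n − γ sets S ∪ {x} with x ∉ S are neighbours
-- of S. Hence the dominating set A = V ∖ N(s) has at most γ elements, so it is minimum,
-- and therefore a vertex not adjacent to s has all its neighbours in N(s).
--
-- If γ + 2 ≤ k, fix x₀ ∉ S: the sets S and S ∪ {x₀, x} give n − γ vertices of A, and
-- V ∖ S, which is also dominating, gives one more; so n − γ < γ, against the
-- minimality of S. Hence k = γ + 1.
--
-- A vertex r ≠ s not adjacent to s corresponds to a minimum dominating set R ≠ S, and
-- every R ∪ {z} with z ∉ R is adjacent to S, so contains it. Hence V ∖ R is a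
-- singleton and γ ≤ 1, whereas A contains both r and s. So s is adjacent to all other
-- vertices, γ = 1, and these are pairwise nonadjacent because D k G is bipartite by
-- cardinality. Finally n ≤ 3 is impossible: V ∖ S would be a vertex of D k G, hence
-- adjacent to S.
module Submission where

open import Defs
open import Data.Nat using (ℕ; _≤_; _∸_; NonZero)
open import Data.Fin using (Fin)
open import Data.Product using (_×_)
open import Relation.Binary.PropositionalEquality using (_≡_)

open import Data.Fin using (zero; suc; punchIn; punchOut; _≟_)
open import Data.Fin.Properties using
  (any?; suc-injective; punchOut-cong; punchOut-punchIn; punchIn-punchOut; punchInᵢ≢i)
open import Data.Fin.Subset using (Subset; inside; outside; _∈_; _∉_; _⊆_; _∪_; _-_; ⁅_⁆; ∣_∣; ∁)
open import Data.Fin.Subset.Properties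
open import Data.Irrelevant using ([_])
open import Data.Nat using (zero; suc; _<_; z≤n; s≤s; _<?_; _≤?_)
open import Data.Nat.Properties as ℕ hiding (_≟_; _≤?_; _<?_; suc-injective)
open import Data.Product using (_,_; ∃; proj₁; proj₂; map₂)
open import Data.Refinement using (value; _,_; value-injective)
open import Data.Sum using (_⊎_; inj₁; inj₂; swap)
open import Data.Unit using (tt)
open import Data.Vec using ([]; _∷_; here; there)
open import Data.Vec.Properties using (lookup∘tabulate; []=⇒lookup; lookup⇒[]=)
open import Function using (_∘_; _⇔_; Equivalence; Inverse; mk⇔; mk↔ₛ′)
open import Relation.Binary.PropositionalEquality using (refl; sym; trans; cong; subst; _≢_)
open import Relation.Nullary using (¬_; yes; no; does; contradiction; ¬?; recompute)
open import Relation.Nullary.Decidable using (_×-dec_; dec-true; decidable-stable)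

open Graph

private variable
  m n : ℕ
  G : Graph (Fin n)
  S T : Subset n
  u v x y : Fin n

-- Cardinalities of finite subsets.

∣insert∣ : x ∉ S → ∣ S ∪ ⁅ x ⁆ ∣ ≡ suc ∣ S ∣
∣insert∣ {x = zero}  {S = inside  ∷ S} x∉S = contradiction here x∉S
∣insert∣ {x = zero}  {S = outside ∷ S} x∉S = cong (suc ∘ ∣_∣) (∪-identityʳ S)
∣insert∣ {x = suc x} {S = inside  ∷ S} x∉S = cong suc (∣insert∣ (x∉S ∘ there))
∣insert∣ {x = suc x} {S = outside ∷ S} x∉S = ∣insert∣ (x∉S ∘ there)

∣delete∣ : x ∈ S → ∣ S ∣ ≡ suc ∣ S - x ∣
∣delete∣ {S = inside  ∷ S} here        = cong (suc ∘ ∣_∣) (sym (p─⊥≡p S))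
∣delete∣ {S = inside  ∷ S} (there x∈S) = cong suc (∣delete∣ x∈S)
∣delete∣ {S = outside ∷ S} (there x∈S) = ∣delete∣ x∈S

∣insert∣≤ : ∀ (S : Subset n) x → ∣ S ∪ ⁅ x ⁆ ∣ ≤ suc ∣ S ∣
∣insert∣≤ S x with x ∈? S
... | no x∉S  = ≤-reflexive (∣insert∣ x∉S)
... | yes x∈S = m≤n⇒m≤1+n (p⊆q⇒∣p∣≤∣q∣ λ y∈ → absorb (x∈p∪q⁻ S ⁅ x ⁆ y∈))
  where
  absorb : y ∈ S ⊎ y ∈ ⁅ x ⁆ → y ∈ S
  absorb (inj₁ y∈S) = y∈S
  absorb (inj₂ y∈x) = subst (_∈ S) (sym (x∈⁅y⁆⇒x≡y x y∈x)) x∈S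

∈-insert⁻ : y ∈ S ∪ ⁅ x ⁆ → y ∉ S → y ≡ x
∈-insert⁻ {S = S} {x = x} y∈ y∉S with x∈p∪q⁻ S ⁅ x ⁆ y∈
... | inj₁ y∈S = contradiction y∈S y∉S
... | inj₂ y∈x = x∈⁅y⁆⇒x≡y x y∈x

∈-insertˡ : y ∈ S → y ∈ S ∪ ⁅ x ⁆
∈-insertˡ = x∈p∪q⁺ ∘ inj₁

∈-insertʳ : ∀ S (x : Fin n) → x ∈ S ∪ ⁅ x ⁆
∈-insertʳ S x = x∈p∪q⁺ {p = S} (inj₂ (x∈⁅x⁆ x))

⊆∧∣∣≥⇒≡ : S ⊆ T → ∣ T ∣ ≤ ∣ S ∣ → S ≡ T
⊆∧∣∣≥⇒≡ {S = S} S⊆T T≤S = ⊆-antisym S⊆T λ {x} x∈T → decidable-stable (x ∈? S) λ x∉S →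
  <⇒≱ (p⊂q⇒∣p∣<∣q∣ (S⊆T , x , x∈T , x∉S)) T≤S

-- Induction on `P`: the image of its first element is deleted from `Q`, and injectivity keeps the
-- other images off it. Injectivity is asked only on `P`, since `x` can be recovered from
-- `S ∪ ⁅ x ⁆` only when `x ∉ S`.
injection⇒∣∣≤ : ∀ {P : Subset m} {Q : Subset n} (g : Fin m → Fin n) →
  (∀ {x} → x ∈ P → g x ∈ Q) →
  (∀ {x y} → x ∈ P → y ∈ P → g x ≡ g y → x ≡ y) → ∣ P ∣ ≤ ∣ Q ∣
injection⇒∣∣≤ {P = []} g maps inj = z≤n
injection⇒∣∣≤ {P = outside ∷ P} g maps inj =
  injection⇒∣∣≤ (g ∘ suc) (maps ∘ there) λ x∈ y∈ → suc-injective ∘ inj (there x∈) (there y∈)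
injection⇒∣∣≤ {P = inside ∷ P} {Q} g maps inj = subst (suc ∣ P ∣ ≤_) (sym (∣delete∣ (maps here))) (s≤s
  (injection⇒∣∣≤ (g ∘ suc)
    (λ x∈ → x∈p∧x≢y⇒x∈p-y (maps (there x∈)) λ gx≡ → contradiction (inj (there x∈) here gx≡) λ ())
    (λ x∈ y∈ → suc-injective ∘ inj (there x∈) (there y∈))))

infix 4 _⋖_

-- The covering relation of the subset lattice, recorded through inclusion and size rather than
-- through the added vertex.
_⋖_ : Subset n → Subset n → Set
S ⋖ T = S ⊆ T × ∣ T ∣ ≡ suc ∣ S ∣

⟶⇒⋖ : S ⟶ T → S ⋖ T ⊎ T ⋖ S
⟶⇒⋖ (v , inj₁ (v∉S , refl)) = inj₁ (∈-insertˡ , ∣insert∣ v∉S)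
⟶⇒⋖ {S = S} (v , inj₂ (v∈S , refl)) = inj₂ (p─q⊆p S ⁅ v ⁆ , ∣delete∣ v∈S)

-- Minimum dominating sets and their complements.

Minimum : Graph (Fin n) → Subset n → Set
Minimum G S = Dominating G S × (∀ T → Dominating G T → ∣ S ∣ ≤ ∣ T ∣)

dominating-⊆ : (G : Graph (Fin n)) → Dominating G S → S ⊆ T → Dominating G T
dominating-⊆ G domS S⊆T v v∉T with domS v (v∉T ∘ S⊆T)
... | u , u∈S , vu = u , S⊆T u∈S , vu

adj⇒≢ : (G : Graph (Fin n)) → Adj G u v → u ≢ v
adj⇒≢ G uv u≡v = adj-irrefl G u≡v uv

-- After the deletion `v` is dominated by `u`, and a vertex that relied on `v` by its substitute
-- from `other`.
delete-dominating : (G : Graph (Fin n)) → Dominating G S → u ∈ S → Adj G v u →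
  (∀ w → w ∉ S → Adj G w v → ∃ λ x → x ∈ S × x ≢ v × Adj G w x) → Dominating G (S - v)
delete-dominating {S = S} {u} {v} G domS u∈S vu other w w∉ with w ≟ v
... | yes refl = u , x∈p∧x≢y⇒x∈p-y u∈S (adj⇒≢ G vu ∘ sym) , vu
... | no w≢v with domS w (λ w∈S → w∉ (x∈p∧x≢y⇒x∈p-y w∈S w≢v))
...   | x , x∈S , wx with x ≟ v
...     | no x≢v = x , x∈p∧x≢y⇒x∈p-y x∈S x≢v , wx
...     | yes refl with other w (λ w∈S → w∉ (x∈p∧x≢y⇒x∈p-y w∈S w≢v)) wx
...       | y , y∈S , y≢v , wy = y , x∈p∧x≢y⇒x∈p-y y∈S y≢v , wy

-- If all neighbours of `v` lay in `S`, then `S - v` would still dominate: one of them dominates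
-- `v`, and nothing outside `S` relied on `v`.
neighbourOutside : (G : Graph (Fin n)) → (∀ v → ∃ (Adj G v)) → Minimum G S → v ∈ S → ∃ λ u → u ∉ S × Adj G v u
neighbourOutside {S = S} {v} G nbr (domS , minS) v∈S
  with any? (λ u → ¬? (u ∈? S) ×-dec adj? G v u)
... | yes found = found
... | no none = contradiction (minS (S - v) smaller) (<⇒≱ (x∈p⇒∣p-x∣<∣p∣ v∈S))
  where
  inS : Adj G v u → u ∈ S
  inS {u} vu = decidable-stable (u ∈? S) λ u∉S → none (u , u∉S , vu)

  smaller : Dominating G (S - v)
  smaller = delete-dominating G domS (inS (proj₂ (nbr v))) (proj₂ (nbr v))
    λ w w∉S wv → contradiction (inS (adj-sym G wv)) w∉S

-- Ore's theorem on complements, for minimum sets in graphs without isolated vertices.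
∁-dominating : (G : Graph (Fin n)) → (∀ v → ∃ (Adj G v)) → Minimum G S → Dominating G (∁ S)
∁-dominating G nbr minS v v∉∁S with neighbourOutside G nbr minS (x∉∁p⇒x∈p v∉∁S)
... | u , u∉S , vu = u , x∉p⇒x∈∁p u∉S , vu

-- Neighbourhoods and the recognition of stars.

∈-neighbours⁺ : Adj G v u → u ∈ neighbours G v
∈-neighbours⁺ {G = G} {v} {u} vu =
  lookup⇒[]= u _ (trans (lookup∘tabulate _ u) (dec-true (adj? G v u) vu))

∈-neighbours⁻ : u ∈ neighbours G v → Adj G v u
∈-neighbours⁻ {u = u} {G = G} {v} u∈
  with adj? G v u | trans (sym (lookup∘tabulate (λ u → does (adj? G v u)) u)) ([]=⇒lookup u∈)
... | yes vu | _ = vu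
... | no _   | ()

starIso : (G : Graph (Fin n)) (s : Fin n) → (∀ v → v ≢ s → Adj G s v) →
  (∀ u v → Adj G s u → Adj G s v → ¬ Adj G u v) → G ≅ K[1, n ∸ 1 ]
starIso {suc n} G s centre indep = record
  { bijection = mk↔ₛ′ to from to∘from from∘to
  ; adj⇔adj   = adj
  }
  where
  to : Fin (suc n) → Fin 1 ⊎ Fin n
  to v with s ≟ v
  ... | yes _  = inj₁ zero
  ... | no s≢v = inj₂ (punchOut s≢v)

  from : Fin 1 ⊎ Fin n → Fin (suc n)
  from (inj₁ _) = s
  from (inj₂ i) = punchIn s i

  to∘from : ∀ i → to (from i) ≡ i
  to∘from (inj₁ zero) with s ≟ s
  ... | yes _  = refl
  ... | no s≢s = contradiction refl s≢s
  to∘from (inj₂ i) with s ≟ punchIn s i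
  ... | yes s≡ = contradiction (sym s≡) (punchInᵢ≢i s i)
  ... | no _   = cong inj₂ (trans (punchOut-cong s refl) (punchOut-punchIn s))

  from∘to : ∀ v → from (to v) ≡ v
  from∘to v with s ≟ v
  ... | yes s≡v = s≡v
  ... | no s≢v  = punchIn-punchOut s≢v

  adj : ∀ u v → Adj G u v ⇔ Adj K[1, n ] (to u) (to v)
  adj u v with s ≟ u | s ≟ v
  ... | yes refl | yes refl = mk⇔ (λ uu → adj-irrefl G refl uu) λ ()
  ... | yes refl | no s≢v   = mk⇔ (λ _ → tt) λ _ → centre v (s≢v ∘ sym)
  ... | no s≢u   | yes refl = mk⇔ (λ _ → tt) λ _ → adj-sym G (centre u (s≢u ∘ sym))
  ... | no s≢u   | no s≢v   =
    mk⇔ (indep u v (centre u (s≢u ∘ sym)) (centre v (s≢v ∘ sym))) λ ()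

-- The correspondence between vertices and dominating sets.

module _ (G : Graph (Fin n)) (nbr : ∀ v → ∃ (Adj G v)) (v₀ : Fin n)
         {S : Subset n} (minS : Minimum G S) {k : ℕ} (iso : G ≅ D k G) where

  open _≅_ iso
  open Inverse bijection using (to; from; strictlyInverseˡ; strictlyInverseʳ)

  f : Fin n → Subset n
  f v = value (to v)

  f-valid : ∀ v → Dominating G (f v) × ∣ f v ∣ ≤ k
  f-valid v with to v
  -- The validity proof is irrelevant; decidability recovers it.
  ... | T , [ valid ] = recompute (dominating? G T ×-dec ∣ T ∣ ≤? k) valid

  ∣S∣≤∣f∣ : ∀ v → ∣ S ∣ ≤ ∣ f v ∣
  ∣S∣≤∣f∣ v = proj₂ minS (f v) (proj₁ (f-valid v))

  f-injective : f u ≡ f v → u ≡ v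
  f-injective {u} {v} fu≡fv = trans (sym (strictlyInverseʳ u))
    (trans (cong from (value-injective fu≡fv)) (strictlyInverseʳ v))

  f-surjective : ∀ T → Dominating G T → ∣ T ∣ ≤ k → ∃ λ v → f v ≡ T
  f-surjective T domT T≤k = from W , cong value (strictlyInverseˡ W)
    where W = T , [ domT , T≤k ]

  adj⇒⋖ : Adj G u v → f u ⋖ f v ⊎ f v ⋖ f u
  adj⇒⋖ {u} {v} uv with Equivalence.to (adj⇔adj u v) uv
  ... | inj₁ u⟶v = ⟶⇒⋖ u⟶v
  ... | inj₂ v⟶u = swap (⟶⇒⋖ v⟶u)

  insert⇒adj : x ∉ f u → f v ≡ f u ∪ ⁅ x ⁆ → Adj G u v
  insert⇒adj {x} {u} {v} x∉ fv≡ = Equivalence.from (adj⇔adj u v) (inj₁ (x , inj₁ (x∉ , fv≡)))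

  -- An edge of `D k G` joins sets of consecutive sizes, the smaller of size at least `∣ S ∣` and
  -- the larger of size at most `k`.
  k>∣S∣ : ∣ S ∣ < k
  k>∣S∣ with nbr v₀
  ... | u , v₀u with adj⇒⋖ v₀u
  ...   | inj₁ (_ , fu≡) =
    ≤-trans (s≤s (∣S∣≤∣f∣ v₀)) (≤-trans (≤-reflexive (sym fu≡)) (proj₂ (f-valid u)))
  ...   | inj₂ (_ , fv≡) =
    ≤-trans (s≤s (∣S∣≤∣f∣ u)) (≤-trans (≤-reflexive (sym fv≡)) (proj₂ (f-valid v₀)))

  preimageS : ∃ λ s → f s ≡ S
  preimageS = f-surjective S (proj₁ minS) (<⇒≤ k>∣S∣)

  s : Fin n
  s = proj₁ preimageS

  fs≡S : f s ≡ S
  fs≡S = proj₂ preimageS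

  adj-s⇒⋖ : Adj G s v → S ⋖ f v
  adj-s⇒⋖ {v} sv with adj⇒⋖ sv
  ... | inj₁ s⋖v = subst (_⋖ f v) fs≡S s⋖v
  ... | inj₂ (_ , fs≡) = contradiction (≤-trans (≤-reflexive (trans (sym fs≡) (cong ∣_∣ fs≡S))) (∣S∣≤∣f∣ v)) 1+n≰n

  -- The non-neighbours of `s`.

  A : Subset n
  A = ∁ (neighbours G s)

  ∈A : ¬ Adj G s v → v ∈ A
  ∈A ¬sv = x∉p⇒x∈∁p (¬sv ∘ ∈-neighbours⁻ {G = G})

  s∈A : s ∈ A
  s∈A = ∈A (adj-irrefl G refl)

  ∣A∣≤∣S∣ : ∣ A ∣ ≤ ∣ S ∣
  ∣A∣≤∣S∣ = begin
    ∣ ∁ (neighbours G s) ∣ ≡⟨ ∣∁p∣≡n∸∣p∣ (neighbours G s) ⟩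
    n ∸ ∣ neighbours G s ∣ ≤⟨ ∸-monoʳ-≤ n (injection⇒∣∣≤ (proj₁ ∘ insertS) maps inj) ⟩
    n ∸ ∣ ∁ S ∣            ≡⟨ cong (n ∸_) (∣∁p∣≡n∸∣p∣ S) ⟩
    n ∸ (n ∸ ∣ S ∣)        ≡⟨ m∸[m∸n]≡n (∣p∣≤n S) ⟩
    ∣ S ∣                  ∎
    where
    open ≤-Reasoning
    insertS : ∀ x → ∃ λ v → f v ≡ S ∪ ⁅ x ⁆
    insertS x = f-surjective (S ∪ ⁅ x ⁆) (dominating-⊆ G (proj₁ minS) ∈-insertˡ)
      (≤-trans (∣insert∣≤ S x) k>∣S∣)

    maps : x ∈ ∁ S → proj₁ (insertS x) ∈ neighbours G s
    maps {x} x∈ = ∈-neighbours⁺ {G = G} (insert⇒adj (subst (x ∉_) (sym fs≡S) (x∈∁p⇒x∉p x∈))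
      (trans (proj₂ (insertS x)) (cong (_∪ ⁅ x ⁆) (sym fs≡S))))

    inj : x ∈ ∁ S → y ∈ ∁ S → proj₁ (insertS x) ≡ proj₁ (insertS y) → x ≡ y
    inj {x} {y} x∈ _ eq = ∈-insert⁻ (subst (x ∈_) S∪x≡S∪y (∈-insertʳ S x)) (x∈∁p⇒x∉p x∈)
      where
      S∪x≡S∪y : S ∪ ⁅ x ⁆ ≡ S ∪ ⁅ y ⁆
      S∪x≡S∪y = trans (sym (proj₂ (insertS x))) (trans (cong f eq) (proj₂ (insertS y)))

  adj-s-or∈A : ∀ v → v ∉ A → Adj G v s
  adj-s-or∈A v v∉A = adj-sym G (∈-neighbours⁻ {G = G} (x∉∁p⇒x∈p v∉A))

  A-dominating : Dominating G A
  A-dominating v v∉A = s , s∈A , adj-s-or∈A v v∉A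

  -- Otherwise A - r would be a dominating set smaller than S.
  nonneighbour-adj : ¬ Adj G s u → Adj G u v → Adj G s v
  nonneighbour-adj {r} {r′} ¬sr rr′ with adj? G s r′
  ... | yes sr′ = sr′
  ... | no ¬sr′ = contradiction (proj₂ minS (A - r) smaller)
          (<⇒≱ (<-≤-trans (x∈p⇒∣p-x∣<∣p∣ (∈A ¬sr)) ∣A∣≤∣S∣))
    where
    smaller : Dominating G (A - r)
    smaller = delete-dominating G A-dominating (∈A ¬sr′) rr′
      λ w w∉A _ → s , s∈A , (λ { refl → ¬sr′ rr′ }) , adj-s-or∈A w w∉A

  ∁S-dominating : Dominating G (∁ S)
  ∁S-dominating = ∁-dominating G nbr minS

  elementS : ∃ (_∈ S)
  elementS with v₀ ∈? S
  ... | yes v₀∈S = v₀ , v₀∈S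
  ... | no v₀∉S  = map₂ proj₁ (proj₁ minS v₀ v₀∉S)

  S⊈∁S : ¬ S ⊆ ∁ S
  S⊈∁S S⊆∁S = x∈p⇒x∉∁p (proj₂ elementS) (S⊆∁S (proj₂ elementS))

  elementOutsideS : ∃ (_∉ S)
  elementOutsideS = map₂ proj₁ (neighbourOutside G nbr minS (proj₂ elementS))

  -- Excluding `k ≥ γ + 2`.

  module k≥γ+2 (2+∣S∣≤k : suc (suc ∣ S ∣) ≤ k) where

    x₀ : Fin n
    x₀ = proj₁ elementOutsideS

    S₂ : Fin n → Subset n
    S₂ x = (S ∪ ⁅ x₀ ⁆) ∪ ⁅ x ⁆

    S⊆S₂ : S ⊆ S₂ x
    S⊆S₂ = ∈-insertˡ ∘ ∈-insertˡ

    insertS₂ : ∀ x → ∃ λ v → f v ≡ S₂ x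
    insertS₂ x = f-surjective (S₂ x) (dominating-⊆ G (proj₁ minS) S⊆S₂)
      (≤-trans (∣insert∣≤ (S ∪ ⁅ x₀ ⁆) x) (≤-trans (s≤s (∣insert∣≤ S x₀)) 2+∣S∣≤k))

    g : Fin n → Fin n
    g = proj₁ ∘ insertS₂

    x∉S∪x₀ : x ∈ ∁ S - x₀ → x ∉ S ∪ ⁅ x₀ ⁆
    x∉S∪x₀ {x} x∈ x∈S∪x₀ with ∈-insert⁻ x∈S∪x₀ (x∈∁p⇒x∉p (p─q⊆p (∁ S) ⁅ x₀ ⁆ x∈))
    -- Deleting `x₀` a second time changes nothing, yet it would shrink a set that still contained
    -- `x₀`.
    ... | refl = <-irrefl (cong ∣_∣ (p─q─q≡p─q (∁ S) ⁅ x₀ ⁆)) (x∈p⇒∣p-x∣<∣p∣ x∈)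

    ∣S₂∣ : x ∈ ∁ S - x₀ → ∣ S₂ x ∣ ≡ suc (suc ∣ S ∣)
    ∣S₂∣ x∈ = trans (∣insert∣ (x∉S∪x₀ x∈)) (cong suc (∣insert∣ (proj₂ elementOutsideS)))

    -- Sizes decide: `f (g x)` has `∣ S ∣ + 2` elements, whereas a neighbour of `s` yields
    -- `∣ S ∣ + 1` and `s` itself `∣ S ∣`.
    g-maps : x ∈ ∁ S - x₀ → g x ∈ A - s
    g-maps {x} x∈ = x∈p∧x≢y⇒x∈p-y
      (∈A λ sg → 1+n≢n (trans (sym ∣fg∣) (proj₂ (adj-s⇒⋖ sg))))
      λ g≡s → m≢1+n+m ∣ S ∣ {1} (trans (cong ∣_∣ (trans (sym fs≡S) (cong f (sym g≡s)))) ∣fg∣)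
      where
      ∣fg∣ : ∣ f (g x) ∣ ≡ suc (suc ∣ S ∣)
      ∣fg∣ = trans (cong ∣_∣ (proj₂ (insertS₂ x))) (∣S₂∣ x∈)

    g-injective : x ∈ ∁ S - x₀ → y ∈ ∁ S - x₀ → g x ≡ g y → x ≡ y
    g-injective {x} {y} x∈ _ gx≡gy = ∈-insert⁻ (subst (x ∈_) S₂x≡S₂y (∈-insertʳ (S ∪ ⁅ x₀ ⁆) x)) (x∉S∪x₀ x∈)
      where
      S₂x≡S₂y : S₂ x ≡ S₂ y
      S₂x≡S₂y = trans (sym (proj₂ (insertS₂ x))) (trans (cong f gx≡gy) (proj₂ (insertS₂ y)))

    ∣∁S∣≡ : ∣ ∁ S ∣ ≡ suc ∣ ∁ S - x₀ ∣
    ∣∁S∣≡ = ∣delete∣ (x∉p⇒x∈∁p (proj₂ elementOutsideS))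

    -- This weak bound makes `∁ S` small enough to be a vertex of `D k G`; the preimage `c` of that
    -- vertex then makes the inequality strict.
    ∣∁S∣≤∣S∣ : ∣ ∁ S ∣ ≤ ∣ S ∣
    ∣∁S∣≤∣S∣ = begin
      ∣ ∁ S ∣            ≡⟨ ∣∁S∣≡ ⟩
      suc ∣ ∁ S - x₀ ∣   ≤⟨ s≤s (injection⇒∣∣≤ g g-maps g-injective) ⟩
      suc ∣ A - s ∣      ≡⟨ sym (∣delete∣ s∈A) ⟩
      ∣ A ∣              ≤⟨ ∣A∣≤∣S∣ ⟩
      ∣ S ∣              ∎
      where open ≤-Reasoning

    preimage∁S : ∃ λ c → f c ≡ ∁ S
    preimage∁S = f-surjective (∁ S) ∁S-dominating (≤-trans ∣∁S∣≤∣S∣ (<⇒≤ k>∣S∣))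

    c : Fin n
    c = proj₁ preimage∁S

    S⊈fc : ¬ S ⊆ f c
    S⊈fc S⊆fc = S⊈∁S (subst (S ⊆_) (proj₂ preimage∁S) S⊆fc)

    c∈A-s : c ∈ A - s
    c∈A-s = x∈p∧x≢y⇒x∈p-y (∈A λ sc → S⊈fc (proj₁ (adj-s⇒⋖ sc)))
      λ c≡s → S⊈fc (⊆-reflexive (trans (sym fs≡S) (cong f (sym c≡s))))

    impossible : ∣ ∁ S ∣ < ∣ S ∣
    impossible = begin-strict
      ∣ ∁ S ∣              ≡⟨ ∣∁S∣≡ ⟩
      suc ∣ ∁ S - x₀ ∣     ≤⟨ s≤s (injection⇒∣∣≤ g maps g-injective) ⟩
      suc ∣ A - s - c ∣    ≡⟨ sym (∣delete∣ c∈A-s) ⟩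
      ∣ A - s ∣            <⟨ x∈p⇒∣p-x∣<∣p∣ s∈A ⟩
      ∣ A ∣                ≤⟨ ∣A∣≤∣S∣ ⟩
      ∣ S ∣                ∎
      where
      open ≤-Reasoning
      maps : x ∈ ∁ S - x₀ → g x ∈ A - s - c
      maps {x} x∈ = x∈p∧x≢y⇒x∈p-y (g-maps x∈)
        -- `f (g x)` contains `S`, but `f c` is its complement.
        λ gx≡c → S⊈fc (subst (S ⊆_) (trans (sym (proj₂ (insertS₂ x))) (cong f gx≡c)) S⊆S₂)

  k≤1+∣S∣ : k ≤ suc ∣ S ∣
  k≤1+∣S∣ with suc ∣ S ∣ <? k
  ... | no k≯    = ≮⇒≥ k≯
  ... | yes 2+≤k = contradiction (proj₂ minS (∁ S) ∁S-dominating) (<⇒≱ (k≥γ+2.impossible 2+≤k))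

  k≡1+∣S∣ : k ≡ suc ∣ S ∣
  k≡1+∣S∣ = ≤-antisym k≤1+∣S∣ k>∣S∣

  -- A second non-neighbour of `s`.

  module Nonneighbour {r : Fin n} (¬sr : ¬ Adj G s r) (r≢s : r ≢ s) where

    R : Subset n
    R = f r

    -- A neighbour of `r` is also one of `s`, so its set has `∣ S ∣ + 1` elements; `R` then has
    -- `∣ S ∣` or `∣ S ∣ + 2`, and the latter exceeds `k`.
    ∣R∣≤∣S∣ : ∣ R ∣ ≤ ∣ S ∣
    ∣R∣≤∣S∣ with nbr r
    ... | u , ru with adj-s⇒⋖ (nonneighbour-adj ¬sr ru) | adj⇒⋖ ru
    ...   | _ , fu≡ | inj₁ (_ , fu≡′) = ≤-reflexive (ℕ.suc-injective (trans (sym fu≡′) fu≡))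
    ...   | _ , fu≡ | inj₂ (_ , fr≡)  = contradiction
      (≤-trans (≤-reflexive (sym (trans fr≡ (cong suc fu≡)))) (≤-trans (proj₂ (f-valid r)) k≤1+∣S∣)) 1+n≰n

    minR : Minimum G R
    minR = proj₁ (f-valid r) , λ U domU → ≤-trans ∣R∣≤∣S∣ (proj₂ minS U domU)

    S⊆R∪z : ∀ z → z ∉ R → S ⊆ R ∪ ⁅ z ⁆
    S⊆R∪z z z∉R with f-surjective (R ∪ ⁅ z ⁆) (dominating-⊆ G (proj₁ minR) ∈-insertˡ)
                       (≤-trans (∣insert∣≤ R z) (≤-trans (s≤s ∣R∣≤∣S∣) k>∣S∣))
    ... | q , fq≡ = subst (S ⊆_) fq≡ (proj₁ (adj-s⇒⋖ (nonneighbour-adj ¬sr (insert⇒adj z∉R fq≡))))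

    S∖R-nonempty : ∃ λ w → w ∈ S × w ∉ R
    S∖R-nonempty with any? (λ w → (w ∈? S) ×-dec ¬? (w ∈? R))
    ... | yes found = found
    ... | no none = contradiction (f-injective (trans (sym S≡R) (sym fs≡S))) r≢s
      where
      S≡R : S ≡ R
      S≡R = ⊆∧∣∣≥⇒≡ (λ {x} x∈S → decidable-stable (x ∈? R) λ x∉R → none (x , x∈S , x∉R)) ∣R∣≤∣S∣

    ∣∁R∣≤1 : ∣ ∁ R ∣ ≤ 1
    ∣∁R∣≤1 with S∖R-nonempty
    -- A fixed `w` in `S` but not in `R` lies in every `R ∪ ⁅ z ⁆` with `z ∉ R`, which forces
    -- `w ≡ z`.
    ... | w , w∈S , w∉R = subst (∣ ∁ R ∣ ≤_) (∣⁅x⁆∣≡1 w) (p⊆q⇒∣p∣≤∣q∣ λ {z} z∈ →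
      subst (_∈ ⁅ w ⁆) (∈-insert⁻ (S⊆R∪z z (x∈∁p⇒x∉p z∈) w∈S) w∉R) (x∈⁅x⁆ w))

    ∣A∣≤1 : ∣ A ∣ ≤ 1
    ∣A∣≤1 = ≤-trans ∣A∣≤∣S∣ (≤-trans (proj₂ minS (∁ R) (∁-dominating G nbr minR)) ∣∁R∣≤1)

    1<∣A∣ : 1 < ∣ A ∣
    1<∣A∣ = ≤-<-trans (≤-<-trans z≤n (x∈p⇒∣p-x∣<∣p∣ (x∈p∧x≢y⇒x∈p-y s∈A (r≢s ∘ sym))))
      (x∈p⇒∣p-x∣<∣p∣ (∈A ¬sr))

  -- The star and its order.

  adj-centre : ∀ v → v ≢ s → Adj G s v
  adj-centre v v≢s = decidable-stable (adj? G s v) λ ¬sv →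
    contradiction (Nonneighbour.∣A∣≤1 ¬sv v≢s) (<⇒≱ (Nonneighbour.1<∣A∣ ¬sv v≢s))

  ∣S∣≡1 : ∣ S ∣ ≡ 1
  ∣S∣≡1 = ≤-antisym
    (subst (∣ S ∣ ≤_) (∣⁅x⁆∣≡1 s) (proj₂ minS ⁅ s ⁆ λ v v∉ →
      s , x∈⁅x⁆ s , adj-sym G (adj-centre v λ { refl → v∉ (x∈⁅x⁆ s) })))
    (≤-<-trans z≤n (x∈p⇒∣p-x∣<∣p∣ (proj₂ elementS)))

  k≡2 : k ≡ 2
  k≡2 = trans k≡1+∣S∣ (cong suc ∣S∣≡1)

  isStar : G ≅ K[1, n ∸ 1 ]
  isStar = starIso G s adj-centre independent
    where
    independent : ∀ u v → Adj G s u → Adj G s v → ¬ Adj G u v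
    independent u v su sv uv with adj-s⇒⋖ su | adj-s⇒⋖ sv | adj⇒⋖ uv
    ... | _ , fu≡ | _ , fv≡ | inj₁ (_ , fv≡1+fu) = 1+n≢n (trans (sym fv≡1+fu) (trans fv≡ (sym fu≡)))
    ... | _ , fu≡ | _ , fv≡ | inj₂ (_ , fu≡1+fv) = 1+n≢n (trans (sym fu≡1+fv) (trans fu≡ (sym fv≡)))

  n≥4 : 4 ≤ n
  -- For `n ≤ 3` the complement of `S` has at most `3 ∸ 1` elements, which is `k`.
  n≥4 = ≰⇒> λ n≤3 → ∁S-large (≤-trans (≤-reflexive (∣∁p∣≡n∸∣p∣ S))
      (≤-trans (∸-mono n≤3 (≤-reflexive (sym ∣S∣≡1))) (≤-reflexive (sym k≡2))))
    where
    ∁S-large : ¬ ∣ ∁ S ∣ ≤ k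
    ∁S-large ∁S≤k with f-surjective (∁ S) ∁S-dominating ∁S≤k
    ... | c , fc≡ with c ≟ s
    ...   | yes refl = S⊈∁S (⊆-reflexive (trans (sym fs≡S) fc≡))
    ...   | no c≢s   = S⊈∁S (subst (S ⊆_) fc≡ (proj₁ (adj-s⇒⋖ (adj-centre c c≢s))))

-- From minimum degree and `γ` to the hypotheses used above.

δ≥1⇒neighbour : ∀ {n} .{{_ : NonZero n}} (G : Graph (Fin n)) → 1 ≤ δ G → ∀ v → ∃ (Adj G v)
δ≥1⇒neighbour {n} G 1≤δ v with nonempty? (neighbours G v)
... | yes (u , u∈) = u , ∈-neighbours⁻ {G = G} u∈
... | no empty = contradiction (≤-trans 1≤δ (proj₂ (proj₂ (minimalDegree G)) (degree G v) (v , refl)))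
  (subst (λ N → ¬ 1 ≤ ∣ N ∣) (sym (Empty-unique empty)) (subst (¬_ ∘ (1 ≤_)) (sym (∣⊥∣≡0 n)) λ ()))

theorem3p1 : (n : ℕ) .{{_ : NonZero n}} (G : Graph (Fin n)) → 2 ≤ n → 1 ≤ δ G →
    (k : ℕ) → γ G ≤ k → k ≤ n → G ≅ D k G →
    (k ≡ 2) × (4 ≤ n) × (G ≅ K[1, n ∸ 1 ])
theorem3p1 (suc n) G _ 1≤δ k _ _ iso with proj₂ (minimalDominatingSize G)
-- `zero` serves as `v₀`, the vertex that yields an edge of `D k G` and an element of `S`.
... | (S , domS , ∣S∣≡γ) , γ≤ = k≡2 G nbr zero minS iso , n≥4 G nbr zero minS iso , isStar G nbr zero minS iso
  where
  nbr : ∀ v → ∃ (Adj G v)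
  nbr = δ≥1⇒neighbour G 1≤δ

  minS : Minimum G S
  minS = domS , λ T domT → subst (_≤ ∣ T ∣) (sym ∣S∣≡γ) (γ≤ ∣ T ∣ (T , domT , refl))
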